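{- For every integer $k\ge 1$, let $\mathcal{F}^2(k)=\gcd\{\sum_{i=1}^k F_{n+i}^2 : n \ge 0\}$. Then $$\mathcal{F}^2(k) = \begin{cases} F_k, & \text{if $k$ is even},\\ 2, & \text{if $k \equiv 3 \pmod{6}$},\\ 1, & \text{if $k \equiv 1,5 \pmod{6}$}.\end{cases}$$
   Context: $(F_n)$ is the Fibonacci sequence: $F_0=0$, $F_1=1$, $F_n=F_{n-1}+F_{n-2}$. -}

module Defs where

open import Data.Nat using (ℕ; zero; suc; _+_; _^_)
open import Data.Nat.Divisibility using (_∣_; ∣-antisym)
open import Data.Nat.ListAction using (sum)
open import Data.List using (map; applyUpTo)
open import Relation.Binary.PropositionalEquality using (_≡_)

fib : ℕ → ℕ
fib zero          = 0
fib (suc zero)    = 1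
fib (suc (suc n)) = fib (suc n) + fib n

-- The index list applyUpTo suc k is 1, 2, …, k.
fibSquareSum : ℕ → ℕ → ℕ
fibSquareSum k n = sum (map (λ i → fib (n + i) ^ 2) (applyUpTo suc k))

-- The gcd of an infinite set { f i : i ∈ I } has no defining algorithm, so it
-- is given, like Data.Nat.GCD.GCD for two numbers, by its universal property.
record IsGCD {I : Set} (f : I → ℕ) (g : ℕ) : Set where
  field
    commonDivisor : ∀ i → g ∣ f i
    greatest      : ∀ {d} → (∀ i → d ∣ f i) → d ∣ g

-- Hence IsGCD f g may be read as the equation gcd { f i : i ∈ I } = g.
IsGCD-unique : ∀ {I : Set} {f : I → ℕ} {g h} → IsGCD f g → IsGCD f h → g ≡ h
IsGCD-unique p q = ∣-antisym
  (IsGCD.greatest q (IsGCD.commonDivisor p))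
  (IsGCD.greatest p (IsGCD.commonDivisor q))

ℱ²[_]≡_ : ℕ → ℕ → Set
ℱ²[ k ]≡ g = IsGCD (fibSquareSum k) g

{-# OPTIONS --safe #-}

-- Write S(k, n) for the sum. Since x_n = F_n² satisfies
-- x_{n+3} + x_n = 2 (x_{n+2} + x_{n+1}), the defect
-- S(k, n+2) + S(k, n) − 3 S(k, n+1) depends only on n and the parity of k.
-- For even k it is 0, so the gcd is that of S(k, 0) = F_k F_{k+1} and
-- S(k, 1) = F_k F_{k+3}, which is F_k because consecutive Fibonacci numbers are
-- coprime. For odd k and n = 0 it is 2, so every common divisor divides 2, and
-- the parity of S(k, n) depends only on n and k mod 3, because three
-- consecutive Fibonacci squares have an even sum.
module Submission where

open import Data.Nat using (ℕ; zero; suc; _+_; _*_; _^_; _≥_; _%_; _/_)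
open import Data.Nat.Properties using (+-suc; +-identityʳ; +-comm; +-assoc; *-identityʳ)
open import Data.Nat.Divisibility
  using (_∣_; divides; ∣-refl; 1∣_; m∣m*n; ∣m⇒∣m*n; ∣n⇒∣m*n; ∣m∣n⇒∣m+n; ∣m+n∣m⇒∣n)
open import Data.Nat.DivMod using (m≡m%n+[m/n]*n)
open import Data.Nat.ListAction using (sum)
open import Data.Nat.ListAction.Properties using (sum-++)
open import Data.Nat.Solver using (module +-*-Solver)
open import Data.Nat.Tactic.RingSolver using (solve-∀)
open import Data.List using (map; applyUpTo; _∷ʳ_)
open import Data.List.Properties using (applyUpTo-∷ʳ; map-++)
open import Data.Product using (_×_; _,_)
open import Data.Sum using (_⊎_; inj₁; inj₂)
open import Relation.Binary.PropositionalEquality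
  using (_≡_; refl; sym; trans; cong; cong₂; subst; module ≡-Reasoning)
open import Defs
open ≡-Reasoning
open +-*-Solver using (solve; _:=_; _:+_; _:*_; _:^_; con)

-- Lengthening the sum, and its defect

fibSquareSum-suc : ∀ k n → fibSquareSum (suc k) n ≡ fibSquareSum k n + fib (suc (n + k)) ^ 2
fibSquareSum-suc k n = begin
  sum (map f (applyUpTo suc (suc k)))      ≡⟨ cong (λ l → sum (map f l)) (applyUpTo-∷ʳ suc k) ⟨
  sum (map f (applyUpTo suc k ∷ʳ suc k))   ≡⟨ cong sum (map-++ f (applyUpTo suc k) _) ⟩
  sum (map f (applyUpTo suc k) ∷ʳ f (suc k)) ≡⟨ sum-++ (map f (applyUpTo suc k)) _ ⟩
  fibSquareSum k n + (f (suc k) + 0)       ≡⟨ cong (fibSquareSum k n +_) (+-identityʳ _) ⟩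
  fibSquareSum k n + f (suc k)             ≡⟨ cong (λ i → fibSquareSum k n + fib i ^ 2) (+-suc n k) ⟩
  fibSquareSum k n + fib (suc (n + k)) ^ 2 ∎
  where
  f : ℕ → ℕ
  f i = fib (n + i) ^ 2

fibSquareSum-2+ : ∀ k n → fibSquareSum (2 + k) n
  ≡ fibSquareSum k n + (fib (1 + (n + k)) ^ 2 + fib (2 + (n + k)) ^ 2)
fibSquareSum-2+ k n = begin
  fibSquareSum (2 + k) n
    ≡⟨ fibSquareSum-suc (suc k) n ⟩
  fibSquareSum (suc k) n + fib (suc (n + suc k)) ^ 2
    ≡⟨ cong₂ _+_ (fibSquareSum-suc k n) (cong (λ i → fib (suc i) ^ 2) (+-suc n k)) ⟩
  fibSquareSum k n + fib (1 + (n + k)) ^ 2 + fib (2 + (n + k)) ^ 2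
    ≡⟨ +-assoc (fibSquareSum k n) _ _ ⟩
  fibSquareSum k n + (fib (1 + (n + k)) ^ 2 + fib (2 + (n + k)) ^ 2) ∎

-- Adding `x₂ + x₃` to both sides of `x₄ + x₁ ≡ 2 * (x₃ + x₂)` shows that the new terms have defect
-- zero. The defect `c` stays arbitrary so that one induction step serves both parities of the
-- length.
defect-2+ : ∀ {c} n k →
  fibSquareSum k (2 + n) + fibSquareSum k n ≡ 3 * fibSquareSum k (1 + n) + c →
  fibSquareSum (2 + k) (2 + n) + fibSquareSum (2 + k) n ≡ 3 * fibSquareSum (2 + k) (1 + n) + c
defect-2+ {c} n k eq
  rewrite fibSquareSum-2+ k (2 + n) | fibSquareSum-2+ k (1 + n) | fibSquareSum-2+ k n
  = begin
  (s₂ + (x₃ + x₄)) + (s₀ + (x₁ + x₂)) ≡⟨ regroup s₂ s₀ x₁ x₂ x₃ x₄ ⟩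
  (s₂ + s₀) + ((x₃ + x₄) + (x₁ + x₂)) ≡⟨ cong₂ _+_ eq (squares (fib (1 + (n + k))) (fib (n + k))) ⟩
  (3 * s₁ + c) + 3 * (x₂ + x₃)        ≡⟨ collect s₁ (x₂ + x₃) c ⟩
  3 * (s₁ + (x₂ + x₃)) + c            ∎
  where
  s₀ = fibSquareSum k n
  s₁ = fibSquareSum k (1 + n)
  s₂ = fibSquareSum k (2 + n)
  x₁ = fib (1 + (n + k)) ^ 2
  x₂ = fib (2 + (n + k)) ^ 2
  x₃ = fib (3 + (n + k)) ^ 2
  x₄ = fib (4 + (n + k)) ^ 2

  regroup : ∀ s t a b c d → (s + (c + d)) + (t + (a + b)) ≡ (s + t) + ((c + d) + (a + b))
  regroup = solve-∀

  -- With `b` and `a` for `fib (1 + (n + k))` and `fib (n + k)`, each base is the form to which the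
  -- later Fibonacci numbers unfold.
  squares : ∀ b a →
    (((b + a) + b) ^ 2 + (((b + a) + b) + (b + a)) ^ 2) + (b ^ 2 + (b + a) ^ 2)
    ≡ 3 * ((b + a) ^ 2 + ((b + a) + b) ^ 2)
  squares = solve 2 (λ b a →
    (((b :+ a) :+ b) :^ 2 :+ (((b :+ a) :+ b) :+ (b :+ a)) :^ 2) :+ (b :^ 2 :+ (b :+ a) :^ 2)
    := con 3 :* ((b :+ a) :^ 2 :+ ((b :+ a) :+ b) :^ 2)) refl

  collect : ∀ s t c → (3 * s + c) + 3 * t ≡ 3 * (s + t) + c
  collect = solve-∀

fibSquareSum-even-recurrence : ∀ m n →
  fibSquareSum (m * 2) (2 + n) + fibSquareSum (m * 2) n ≡ 3 * fibSquareSum (m * 2) (1 + n) + 0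
fibSquareSum-even-recurrence zero    n = refl
fibSquareSum-even-recurrence (suc m) n = defect-2+ n (m * 2) (fibSquareSum-even-recurrence m n)

-- For odd length the defect alternates between 2 and -2 as `n` grows; the instance `n = 0` can be
-- stated in `ℕ` and is enough to bound the common divisors.
fibSquareSum-odd-defect : ∀ m →
  fibSquareSum (suc (m * 2)) 2 + fibSquareSum (suc (m * 2)) 0 ≡ 3 * fibSquareSum (suc (m * 2)) 1 + 2
fibSquareSum-odd-defect zero    = refl
fibSquareSum-odd-defect (suc m) = defect-2+ 0 (suc (m * 2)) (fibSquareSum-odd-defect m)

-- Even length

fibSquareSum-0 : ∀ k → fibSquareSum k 0 ≡ fib k * fib (1 + k)
fibSquareSum-0 zero    = refl
fibSquareSum-0 (suc k) = begin
  fibSquareSum (suc k) 0                      ≡⟨ fibSquareSum-suc k 0 ⟩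
  fibSquareSum k 0 + fib (1 + k) ^ 2          ≡⟨ cong (_+ fib (1 + k) ^ 2) (fibSquareSum-0 k) ⟩
  fib k * fib (1 + k) + fib (1 + k) ^ 2       ≡⟨ factor (fib k) (fib (1 + k)) ⟩
  fib (1 + k) * fib (2 + k)                   ∎
  where
  factor : ∀ a b → a * b + b ^ 2 ≡ b * (b + a)
  factor = solve 2 (λ a b → a :* b :+ b :^ 2 := b :* (b :+ a)) refl

-- The induction goes in steps of two because the identity fails for odd lengths: at length 1 the
-- sum is 1, while `fib 1 * fib 4` is 3.
fibSquareSum-even-1 : ∀ m → fibSquareSum (m * 2) 1 ≡ fib (m * 2) * fib (3 + m * 2)
fibSquareSum-even-1 zero    = refl
fibSquareSum-even-1 (suc m) = begin
  fibSquareSum (2 + k) 1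
    ≡⟨ fibSquareSum-2+ k 1 ⟩
  fibSquareSum k 1 + (fib (2 + k) ^ 2 + fib (3 + k) ^ 2)
    ≡⟨ cong (_+ (fib (2 + k) ^ 2 + fib (3 + k) ^ 2)) (fibSquareSum-even-1 m) ⟩
  fib k * fib (3 + k) + (fib (2 + k) ^ 2 + fib (3 + k) ^ 2)
    ≡⟨ factor (fib k) (fib (1 + k)) ⟩
  fib (2 + k) * fib (5 + k) ∎
  where
  k = m * 2

  factor : ∀ a b → a * ((b + a) + b) + ((b + a) ^ 2 + ((b + a) + b) ^ 2)
    ≡ (b + a) * ((((b + a) + b) + (b + a)) + ((b + a) + b))
  factor = solve 2 (λ a b →
    a :* ((b :+ a) :+ b) :+ ((b :+ a) :^ 2 :+ ((b :+ a) :+ b) :^ 2)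
    := (b :+ a) :* ((((b :+ a) :+ b) :+ (b :+ a)) :+ ((b :+ a) :+ b))) refl

-- Euclid's descent to `fib 0` and `fib 1`. Carrying the factor `c` through it replaces a
-- cancellation by coprime numbers.
fib-consecutive-coprime : ∀ {d c} k → d ∣ c * fib k → d ∣ c * fib (1 + k) → d ∣ c
fib-consecutive-coprime {d} {c} zero    _ q = subst (d ∣_) (*-identityʳ c) q
fib-consecutive-coprime {d} {c} (suc k) p q =
  fib-consecutive-coprime k (∣m+n∣m⇒∣n (subst (d ∣_) (expand c _ _) q) p) p
  where
  expand : ∀ c a b → c * (a + b) ≡ c * a + c * b
  expand = solve-∀

ℱ²-even : ∀ m → ℱ²[ m * 2 ]≡ fib (m * 2)
ℱ²-even m = record { commonDivisor = common ; greatest = greatest }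
  where
  k = m * 2

  common : ∀ n → fib k ∣ fibSquareSum k n
  common zero          = subst (fib k ∣_) (sym (fibSquareSum-0 k)) (m∣m*n _)
  common (suc zero)    = subst (fib k ∣_) (sym (fibSquareSum-even-1 m)) (m∣m*n _)
  -- The recurrence is read as S(k, n) + S(k, n+2) = 3 S(k, n+1), so divisibility passes from two
  -- neighbouring sums to the next.
  common (suc (suc n)) = ∣m+n∣m⇒∣n
    (subst (fib k ∣_)
      (trans (sym (+-identityʳ _))
        (trans (sym (fibSquareSum-even-recurrence m n)) (+-comm (fibSquareSum k (2 + n)) _)))
      (∣n⇒∣m*n 3 (common (suc n))))
    (common n)

  greatest : ∀ {d} → (∀ n → d ∣ fibSquareSum k n) → d ∣ fib k
  -- Since `fib (3 + k)` unfolds to `fib (2 + k) + fib (1 + k)`, removing S(k, 0) from S(k, 1)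
  -- leaves `fib k * fib (2 + k)`.
  greatest {d} div = fib-consecutive-coprime (1 + k) d∣S₀
    (∣m+n∣m⇒∣n (subst (d ∣_) (expand (fib k) _ _) d∣S₁) d∣S₀)
    where
    d∣S₀ : d ∣ fib k * fib (1 + k)
    d∣S₀ = subst (d ∣_) (fibSquareSum-0 k) (div 0)

    d∣S₁ : d ∣ fib k * fib (3 + k)
    d∣S₁ = subst (d ∣_) (fibSquareSum-even-1 m) (div 1)

    expand : ∀ c a b → c * (a + b) ≡ c * b + c * a
    expand = solve-∀

-- Odd length

odd-commonDivisor∣2 : ∀ {d} m → (∀ n → d ∣ fibSquareSum (suc (m * 2)) n) → d ∣ 2
odd-commonDivisor∣2 {d} m div = ∣m+n∣m⇒∣n
  (subst (d ∣_) (fibSquareSum-odd-defect m) (∣m∣n⇒∣m+n (div 2) (div 0)))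
  (∣n⇒∣m*n 3 (div 1))

-- Half of three consecutive squares: a² + b² + (a + b)² = 2 (a² + b (a + b)).
halfSum3 : ℕ → ℕ
halfSum3 m = fib (1 + m) ^ 2 + fib (2 + m) * fib (3 + m)

fibSquareSum-3+ : ∀ k n → fibSquareSum (3 + k) n ≡ 2 * halfSum3 (n + k) + fibSquareSum k n
fibSquareSum-3+ k n = begin
  fibSquareSum (3 + k) n
    ≡⟨ fibSquareSum-2+ (suc k) n ⟩
  fibSquareSum (suc k) n + (fib (1 + (n + suc k)) ^ 2 + fib (2 + (n + suc k)) ^ 2)
    ≡⟨ cong₂ (λ s i → s + (fib (1 + i) ^ 2 + fib (2 + i) ^ 2)) (fibSquareSum-suc k n) (+-suc n k) ⟩
  (fibSquareSum k n + fib (1 + (n + k)) ^ 2) + (fib (2 + (n + k)) ^ 2 + fib (3 + (n + k)) ^ 2)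
    ≡⟨ double (fibSquareSum k n) (fib (1 + (n + k))) (fib (2 + (n + k))) ⟩
  2 * halfSum3 (n + k) + fibSquareSum k n ∎
  where
  double : ∀ s a b → (s + a ^ 2) + (b ^ 2 + (b + a) ^ 2) ≡ 2 * (a ^ 2 + b * (b + a)) + s
  double = solve 3 (λ s a b →
    (s :+ a :^ 2) :+ (b :^ 2 :+ (b :+ a) :^ 2) := con 2 :* (a :^ 2 :+ b :* (b :+ a)) :+ s) refl

∣fibSquareSum⇒∣fibSquareSum-3* : ∀ {d} → d ∣ 2 → ∀ j r n →
  d ∣ fibSquareSum r n → d ∣ fibSquareSum (j * 3 + r) n
∣fibSquareSum⇒∣fibSquareSum-3* d∣2 zero    r n p = p
∣fibSquareSum⇒∣fibSquareSum-3* {d} d∣2 (suc j) r n p =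
  subst (d ∣_) (sym (fibSquareSum-3+ (j * 3 + r) n))
    (∣m∣n⇒∣m+n (∣m⇒∣m*n (halfSum3 (n + (j * 3 + r))) d∣2)
      (∣fibSquareSum⇒∣fibSquareSum-3* d∣2 j r n p))

-- The converse descent cuts the length to its residue `r` mod 3, where one explicit sum can be
-- evaluated.
∣fibSquareSum-3*⇒∣fibSquareSum : ∀ {d} → d ∣ 2 → ∀ j r n →
  d ∣ fibSquareSum (j * 3 + r) n → d ∣ fibSquareSum r n
∣fibSquareSum-3*⇒∣fibSquareSum d∣2 zero    r n p = p
∣fibSquareSum-3*⇒∣fibSquareSum {d} d∣2 (suc j) r n p = ∣fibSquareSum-3*⇒∣fibSquareSum d∣2 j r n
  (∣m+n∣m⇒∣n (subst (d ∣_) (fibSquareSum-3+ (j * 3 + r) n) p)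
    (∣m⇒∣m*n (halfSum3 (n + (j * 3 + r))) d∣2))

ℱ²-3mod6 : ∀ k → k % 6 ≡ 3 → ℱ²[ k ]≡ 2
ℱ²-3mod6 k k%6≡3 = record
  -- The length is used in two forms: as a multiple of 3, which leads down to the empty sum 0, and
  -- as an odd number, which bounds the common divisors by 2.
  { commonDivisor = λ n → subst (λ i → 2 ∣ fibSquareSum i n) (sym k≡3j)
      (∣fibSquareSum⇒∣fibSquareSum-3* ∣-refl (1 + 2 * q) 0 n (divides 0 refl))
  ; greatest = λ {d} div → odd-commonDivisor∣2 (1 + 3 * q)
      (λ n → subst (λ i → d ∣ fibSquareSum i n) k≡1+2m (div n))
  }
  where
  q = k / 6

  k≡3+6q : k ≡ 3 + q * 6
  k≡3+6q = trans (m≡m%n+[m/n]*n k 6) (cong (_+ q * 6) k%6≡3)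

  k≡3j : k ≡ (1 + 2 * q) * 3 + 0
  k≡3j = trans k≡3+6q (lemma q)
    where
    lemma : ∀ q → 3 + q * 6 ≡ (1 + 2 * q) * 3 + 0
    lemma = solve-∀

  k≡1+2m : k ≡ suc ((1 + 3 * q) * 2)
  k≡1+2m = trans k≡3+6q (lemma q)
    where
    lemma : ∀ q → 3 + q * 6 ≡ suc ((1 + 3 * q) * 2)
    lemma = solve-∀

ℱ²-1mod6 : ∀ k → k % 6 ≡ 1 → ℱ²[ k ]≡ 1
ℱ²-1mod6 k k%6≡1 = record { commonDivisor = λ _ → 1∣ _ ; greatest = greatest }
  where
  q = k / 6

  k≡1+6q : k ≡ 1 + q * 6
  k≡1+6q = trans (m≡m%n+[m/n]*n k 6) (cong (_+ q * 6) k%6≡1)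

  asOdd : ∀ q → 1 + q * 6 ≡ suc ((3 * q) * 2)
  asOdd = solve-∀

  mod3 : ∀ q → 1 + q * 6 ≡ (2 * q) * 3 + 1
  mod3 = solve-∀

  greatest : ∀ {d} → (∀ n → d ∣ fibSquareSum k n) → d ∣ 1
  -- The descent ends at S(1, 0) = F₁² = 1.
  greatest {d} div = ∣fibSquareSum-3*⇒∣fibSquareSum d∣2 (2 * q) 1 0
    (subst (λ i → d ∣ fibSquareSum i 0) (trans k≡1+6q (mod3 q)) (div 0))
    where
    d∣2 : d ∣ 2
    d∣2 = odd-commonDivisor∣2 (3 * q)
      (λ n → subst (λ i → d ∣ fibSquareSum i n) (trans k≡1+6q (asOdd q)) (div n))

ℱ²-5mod6 : ∀ k → k % 6 ≡ 5 → ℱ²[ k ]≡ 1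
ℱ²-5mod6 k k%6≡5 = record { commonDivisor = λ _ → 1∣ _ ; greatest = greatest }
  where
  q = k / 6

  k≡5+6q : k ≡ 5 + q * 6
  k≡5+6q = trans (m≡m%n+[m/n]*n k 6) (cong (_+ q * 6) k%6≡5)

  asOdd : ∀ q → 5 + q * 6 ≡ suc ((2 + 3 * q) * 2)
  asOdd = solve-∀

  mod3 : ∀ q → 5 + q * 6 ≡ (1 + 2 * q) * 3 + 2
  mod3 = solve-∀

  greatest : ∀ {d} → (∀ n → d ∣ fibSquareSum k n) → d ∣ 1
  greatest {d} div = ∣m+n∣m⇒∣n d∣5 (∣n⇒∣m*n 2 d∣2)
    where
    d∣2 : d ∣ 2
    d∣2 = odd-commonDivisor∣2 (2 + 3 * q)
      (λ n → subst (λ i → d ∣ fibSquareSum i n) (trans k≡5+6q (asOdd q)) (div n))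

    -- S(2, 1) = F₂² + F₃² = 5; the index n = 0 would not do, as S(2, 0) = 2.
    d∣5 : d ∣ 2 * 2 + 1
    d∣5 = ∣fibSquareSum-3*⇒∣fibSquareSum d∣2 (1 + 2 * q) 2 1
      (subst (λ i → d ∣ fibSquareSum i 1) (trans k≡5+6q (mod3 q)) (div 1))

theorem5p2 : ∀ (k : ℕ) → k ≥ 1 →
    (2 ∣ k → ℱ²[ k ]≡ fib k)
    × (k % 6 ≡ 3 → ℱ²[ k ]≡ 2)
    × (k % 6 ≡ 1 ⊎ k % 6 ≡ 5 → ℱ²[ k ]≡ 1)
theorem5p2 k _ =
    (λ { (divides m refl) → ℱ²-even m })
  , ℱ²-3mod6 k
  , λ { (inj₁ k%6≡1) → ℱ²-1mod6 k k%6≡1 ; (inj₂ k%6≡5) → ℱ²-5mod6 k k%6≡5 }
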